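{- Let $a=(a_1,\ldots,a_n)\in\mathbb{Z}^n$ and $e=(e_1,\ldots,e_n)\in\mathbb{N}^n$, and let $\mathcal{A}_{\mathbb{Z}}$ be the set of words that contain exactly $e_j$ copies of $a_j$ for each $1\le j\le n$ (and no other letters). Then the sweep map $\mathsf{sweep}:\mathcal{A}_{\mathbb{Z}}\to\mathcal{A}_{\mathbb{Z}}$ is a bijection.
   Context: For a word $\mathsf{w}=\mathsf{w}_1\cdots\mathsf{w}_N\in\mathcal{A}_{\mathbb{Z}}$, the level of $\mathsf{w}_j$ is the integer $\ell_j:=\sum_{i=1}^{j}\mathsf{w}_i$. The sweep map is defined as follows: start with the empty word $\mathsf{u}$; for $k=-1,-2,-3,\ldots$ (all negative integers in decreasing order) and then for the nonnegative integers $k$ in decreasing order ending with $\ldots,3,2,1,0$, read $\mathsf{w}$ from right to left and append to $\mathsf{u}$ each letter $\mathsf{w}_j$ with $\ell_j=k$. Set $\mathsf{sweep}(\mathsf{w}):=\mathsf{u}$ (only finitely many $k$ contribute). -}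

module Defs where

open import Data.Nat using (ℕ; zero; suc)
open import Data.Integer using (ℤ; +_; -[1+_]; _+_; ∣_∣; _≟_)
open import Data.List using (List; []; _∷_; _++_; reverse; map; filter; concatMap; length)
open import Data.Nat.ListAction using (sum)
open import Data.Vec using (Vec; lookup)
open import Data.Vec.Membership.Propositional renaming (_∈_ to _∈ᵥ_)
open import Data.List.Relation.Unary.All using (All)
open import Data.Fin using (Fin)
open import Data.Product using (_×_; _,_; proj₁; proj₂)
open import Relation.Binary.PropositionalEquality using (_≡_)
open import Function using (_∘_)

levelsFrom : ℤ → List ℤ → List (ℤ × ℤ)
levelsFrom s []       = []
levelsFrom s (x ∷ xs) = (x , s + x) ∷ levelsFrom (s + x) xs

levels : List ℤ → List (ℤ × ℤ)
levels = levelsFrom (+ 0)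

lettersAt : List ℤ → ℤ → List ℤ
lettersAt w k = map proj₁ (filter (λ p → proj₂ p ≟ k) (reverse (levels w)))

-- Bound B with |ℓ_j| ≤ B for all j.
bound : List ℤ → ℕ
bound w = sum (map ∣_∣ w)

negLevels : ℕ → List ℤ
negLevels zero    = []
negLevels (suc m) = negLevels m ++ (-[1+ m ] ∷ [])

nonnegLevels : ℕ → List ℤ
nonnegLevels zero    = + 0 ∷ []
nonnegLevels (suc m) = + suc m ∷ nonnegLevels m

-- sweep: for k = -1, -2, ..., then k = ..., 2, 1, 0, append letters of level k
-- read right to left. Levels outside [-B, B] contribute nothing.
sweep : List ℤ → List ℤ
sweep w = concatMap (lettersAt w) (negLevels (bound w) ++ nonnegLevels (bound w))

countOf : ℤ → List ℤ → ℕ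
countOf x w = length (filter (_≟ x) w)

InA : ∀ {n} → Vec ℤ n → Vec ℕ n → List ℤ → Set
InA {n} a e w =
  ((j : Fin n) → countOf (lookup a j) w ≡ lookup e j) × All (_∈ᵥ a) w

{-# OPTIONS --safe #-}
module Submission where

-- The bijectivity comes down to injectivity: sweep permutes the letters of a word, so its orbits
-- are finite and an injective sweep is surjective.
--
-- Let u and u′ have the same sweep v. Close both words up by a final step back to level 0, which is
-- the last letter of v in either case. Each position z of v gets levels ℓ z and ℓ′ z from u and u′.
-- In sweep order levels are the elements ωε(ℓ) + ℓ of ℤ[ω], where ε(ℓ) = 1 if ℓ < 0 and 0 otherwise,
-- and both level functions decrease along v. Let S be the set of positions where the difference
-- D of the two levels is maximal. Since every level has as many steps ending as starting there,
-- comparing ℓ with ℓ′ + max D - 1 shows that for each k at most as many steps of S end at level k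
-- (under ℓ) as start there. Within a block of constant ℓ the set S is closed under passing to
-- later positions of v, which are the earlier steps of u. So if q is the step of S that comes last
-- in u, every step of u before q that ends at level ℓ q lies in S, and unless S contains the closing
-- step, more steps of S end at ℓ q than start there. Hence max D = 0, and by symmetry ℓ = ℓ′. Finally u is
-- recovered from its levels by walking back from the end.

open import Defs
open import Data.Nat as ℕ using (ℕ; zero; suc)
import Data.Nat.Properties as ℕ
open import Data.Nat.GeneralisedArithmetic using (fold)
open import Data.Nat.ListAction.Properties using (sum-↭)
open import Data.Integer as ℤ
  using (ℤ; -[1+_]; 0ℤ; 1ℤ; _+_; _-_; -_; _≤_; _<_; +≤+; +<+; -<-; _≟_; _≤?_; _<?_; ∣_∣)
import Data.Integer.Properties as ℤ
open import Data.Integer.Tactic.RingSolver using (solve-∀)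
open import Data.Fin using (Fin; zero; suc; toℕ; finToFun; funToFin)
import Data.Fin.Properties as Fin
open import Data.Vec as Vec using (Vec)
open import Data.List
  using (List; []; _∷_; _++_; _∷ʳ_; [_]; map; filter; concatMap; length; reverse; lookup; tabulate)
import Data.List.Properties as List
open import Data.List.Membership.Propositional using (_∈_)
open import Data.List.Membership.Propositional.Properties
  using (∈-filter⁺; ∈-filter⁻; ∈-map⁺; ∈-++⁺ˡ; ∈-++⁺ʳ)
open import Data.List.Relation.Unary.All as All using (All; []; _∷_)
import Data.List.Relation.Unary.All.Properties as All
open import Data.List.Relation.Unary.AllPairs as AllPairs using (AllPairs; []; _∷_)
import Data.List.Relation.Unary.AllPairs.Properties as AllPairs
open import Data.List.Relation.Unary.Any as Any using (here; there)
import Data.List.Relation.Unary.Any.Properties as Any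
open import Data.List.Relation.Binary.Permutation.Propositional
  using (_↭_; refl; prep; swap; trans; ↭-sym; ↭-trans; ↭-reflexive; module PermutationReasoning)
open import Data.List.Relation.Binary.Permutation.Propositional.Properties
  using (∈-resp-↭; All-resp-↭; map⁺; filter-↭; shift; ++⁺ˡ; ∷↭∷ʳ; ↭-reverse; ↭-length)
open import Data.Product using (Σ; ∃; _×_; _,_; proj₁; proj₂)
open import Data.Product.Properties using (≡-dec)
open import Data.Sum using (_⊎_; inj₁; inj₂; [_,_]′)
open import Data.Empty using (⊥; ⊥-elim)
open import Function using (_∘_)
open import Relation.Nullary using (Dec; yes; no; ¬_)
open import Relation.Nullary.Decidable using (_×-dec_; toSum)
open import Relation.Nullary.Negation using (contradiction)
open import Relation.Unary using (Decidable)
open import Relation.Binary.Definitions using (tri<; tri≈; tri>)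
open import Relation.Binary.PropositionalEquality as ≡
  using (_≡_; _≢_; refl; sym; cong; cong₂; subst; module ≡-Reasoning)

private variable
  A B : Set
  P Q : Set

-- Reduces a linear inequality to an identity between the gaps of two inequalities, which the ring
-- solver proves.
≤-by : ∀ {a b c d} → a ≤ b → d - c ≡ b - a → c ≤ d
≤-by a≤b eq = ℤ.0≤i-j⇒j≤i (subst (0ℤ ≤_) (sym eq) (ℤ.i≤j⇒0≤j-i a≤b))

-- Indicators and finite sums of integers.

⟦_⟧ : Dec P → ℤ
⟦ yes _ ⟧ = 1ℤ
⟦ no  _ ⟧ = 0ℤ

0≤⟦_⟧ : (p : Dec P) → 0ℤ ≤ ⟦ p ⟧
0≤⟦ yes _ ⟧ = +≤+ ℕ.z≤n
0≤⟦ no  _ ⟧ = ℤ.≤-refl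

⟦_⟧≤1 : (p : Dec P) → ⟦ p ⟧ ≤ 1ℤ
⟦ yes _ ⟧≤1 = ℤ.≤-refl
⟦ no  _ ⟧≤1 = +≤+ ℕ.z≤n

⟦⟧-true : (p : Dec P) → P → ⟦ p ⟧ ≡ 1ℤ
⟦⟧-true (yes _) _ = refl
⟦⟧-true (no ¬p) p = contradiction p ¬p

⟦⟧-false : (p : Dec P) → ¬ P → ⟦ p ⟧ ≡ 0ℤ
⟦⟧-false (yes p) ¬p = contradiction p ¬p
⟦⟧-false (no _)  _  = refl

⟦⟧-mono : (p : Dec P) (q : Dec Q) → (P → Q) → ⟦ p ⟧ ≤ ⟦ q ⟧
⟦⟧-mono (yes p) q f = ℤ.≤-reflexive (sym (⟦⟧-true q (f p)))
⟦⟧-mono (no _)  q f = 0≤⟦ q ⟧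

⟦⟧-cong : (p : Dec P) (q : Dec Q) → (P → Q) → (Q → P) → ⟦ p ⟧ ≡ ⟦ q ⟧
⟦⟧-cong p q f g = ℤ.≤-antisym (⟦⟧-mono p q f) (⟦⟧-mono q p g)

∑ : (A → ℤ) → List A → ℤ
∑ f []       = 0ℤ
∑ f (x ∷ xs) = f x + ∑ f xs

interchange : ∀ a b c d → (a + b) + (c + d) ≡ (a + c) + (b + d)
interchange = solve-∀

∑-+ : ∀ (f g : A → ℤ) xs → ∑ (λ x → f x + g x) xs ≡ ∑ f xs + ∑ g xs
∑-+ f g []       = refl
∑-+ f g (x ∷ xs) = ≡.trans (cong ((f x + g x) +_) (∑-+ f g xs)) (interchange (f x) (g x) (∑ f xs) (∑ g xs))

∑-mono : ∀ {f g : A → ℤ} xs → (∀ {x} → x ∈ xs → f x ≤ g x) → ∑ f xs ≤ ∑ g xs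
∑-mono []       f≤g = ℤ.≤-refl
∑-mono (x ∷ xs) f≤g = ℤ.+-mono-≤ (f≤g (here refl)) (∑-mono xs (f≤g ∘ there))

∑-cong : ∀ {f g : A → ℤ} xs → (∀ {x} → x ∈ xs → f x ≡ g x) → ∑ f xs ≡ ∑ g xs
∑-cong []       f≡g = refl
∑-cong (x ∷ xs) f≡g = cong₂ _+_ (f≡g (here refl)) (∑-cong xs (f≡g ∘ there))

∑-map : ∀ (f : B → ℤ) (g : A → B) xs → ∑ f (map g xs) ≡ ∑ (f ∘ g) xs
∑-map f g []       = refl
∑-map f g (x ∷ xs) = cong (f (g x) +_) (∑-map f g xs)

left-comm : ∀ a b c → a + (b + c) ≡ b + (a + c)
left-comm = solve-∀

∑-↭ : ∀ (f : A → ℤ) {xs ys} → xs ↭ ys → ∑ f xs ≡ ∑ f ys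
∑-↭ f refl         = refl
∑-↭ f (prep x p)   = cong (f x +_) (∑-↭ f p)
∑-↭ f {_ ∷ _ ∷ xs} (swap x y p) =
  ≡.trans (left-comm (f x) (f y) (∑ f xs)) (cong (λ s → f y + (f x + s)) (∑-↭ f p))
∑-↭ f (trans p q)  = ≡.trans (∑-↭ f p) (∑-↭ f q)

-- Sorted lists, maxima and the lexicographic order on pairs.

AllPairs-compare : ∀ {R : A → A → Set} {xs a b} → AllPairs R xs → a ∈ xs → b ∈ xs → a ≡ b ⊎ R a b ⊎ R b a
AllPairs-compare _          (here refl) (here refl) = inj₁ refl
AllPairs-compare (rs ∷ _)   (here refl) (there b∈)  = inj₂ (inj₁ (All.lookup rs b∈))
AllPairs-compare (rs ∷ _)   (there a∈)  (here refl) = inj₂ (inj₂ (All.lookup rs a∈))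
AllPairs-compare (_ ∷ rss)  (there a∈)  (there b∈)  = AllPairs-compare rss a∈ b∈

maximum : ∀ {R : A → A → Set} → (∀ a b → R a b ⊎ R b a) → (∀ {a b c} → R a b → R b c → R a c) →
          ∀ {x xs} → x ∈ xs → ∃ λ m → m ∈ xs × (∀ {y} → y ∈ xs → R y m)
maximum {R = R} total R-trans {xs = x ∷ xs} _ = go x xs
  where
  R-refl : ∀ a → R a a
  R-refl a with total a a
  ... | inj₁ r = r
  ... | inj₂ r = r

  go : ∀ x xs → ∃ λ m → m ∈ x ∷ xs × (∀ {y} → y ∈ x ∷ xs → R y m)
  go x []       = x , here refl , λ { (here refl) → R-refl x }
  go x (y ∷ ys) with go y ys
  ... | m , m∈ , max with total x m
  ... | inj₁ x≤m = m , there m∈ , λ { (here refl) → x≤m ; (there z∈) → max z∈ }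
  ... | inj₂ m≤x = x , here refl , λ { (here refl) → R-refl x ; (there z∈) → R-trans (max z∈) m≤x }

-- The pair `(p , a)` stands for the element ωp + a of ℤ[ω].
_≼_ : ℤ × ℤ → ℤ × ℤ → Set
(p , a) ≼ (q , b) = p < q ⊎ (p ≡ q × a ≤ b)

≼-total : ∀ x y → x ≼ y ⊎ y ≼ x
≼-total (p , a) (q , b) with ℤ.<-cmp p q
... | tri< p<q _ _ = inj₁ (inj₁ p<q)
... | tri> _ _ q<p = inj₂ (inj₁ q<p)
... | tri≈ _ p≡q _ with ℤ.≤-total a b
... | inj₁ a≤b = inj₁ (inj₂ (p≡q , a≤b))
... | inj₂ b≤a = inj₂ (inj₂ (sym p≡q , b≤a))

≼-trans : ∀ {x y z} → x ≼ y → y ≼ z → x ≼ z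
≼-trans (inj₁ p)          (inj₁ q)          = inj₁ (ℤ.<-trans p q)
≼-trans (inj₁ p)          (inj₂ (refl , _)) = inj₁ p
≼-trans (inj₂ (refl , _)) (inj₁ q)          = inj₁ q
≼-trans (inj₂ (refl , p)) (inj₂ (refl , q)) = inj₂ (refl , ℤ.≤-trans p q)

≼-antisym : ∀ {x y} → x ≼ y → y ≼ x → x ≡ y
≼-antisym (inj₁ p)          (inj₁ q)       = contradiction q (ℤ.<-asym p)
≼-antisym (inj₁ p)          (inj₂ (r , _)) = contradiction p (ℤ.<-irrefl (sym r))
≼-antisym (inj₂ (r , _))    (inj₁ q)       = contradiction q (ℤ.<-irrefl (sym r))
≼-antisym (inj₂ (refl , p)) (inj₂ (_ , q)) = cong (_ ,_) (ℤ.≤-antisym p q)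

-- The sweep order of levels and its threshold functions.

-- The sweep visits -1, -2, … before …, 2, 1, 0, so level a is treated as ωε(a) + a.
ε : ℤ → ℤ
ε a = ⟦ a <? 0ℤ ⟧

_≻_ : ℤ → ℤ → Set
a ≻ b = ε b < ε a ⊎ (ε a ≡ ε b × b < a)

-- The number of j ≥ 0 with k ≤ ωε(a) + a - ωj.
h : ℤ → ℤ → ℤ
h k a = ε a + ⟦ k ≤? a ⟧

-- A strict gap between integers is at least 1 and so absorbs an indicator. This is how a drop in
-- the ω-part outweighs any change of a threshold indicator.
shift-≤ : ∀ {p q} (u v : ℤ) → p < q → u ≤ 1ℤ → 0ℤ ≤ v → p + u ≤ q + v
shift-≤ {p} {q} u v p<q u≤1 0≤v = begin
  p + u   ≤⟨ ℤ.+-monoʳ-≤ p u≤1 ⟩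
  p + 1ℤ  ≡⟨ ℤ.+-comm p 1ℤ ⟩
  1ℤ + p  ≤⟨ ℤ.i<j⇒suc[i]≤j p<q ⟩
  q       ≡⟨ ℤ.+-identityʳ q ⟨
  q + 0ℤ  ≤⟨ ℤ.+-monoʳ-≤ q 0≤v ⟩
  q + v   ∎
  where open ℤ.≤-Reasoning

h-mono : ∀ k {a b} → a ≻ b → h k b ≤ h k a
h-mono k {a} {b} (inj₁ lt)        = shift-≤ _ _ lt ⟦ k ≤? b ⟧≤1 0≤⟦ k ≤? a ⟧
h-mono k {a} {b} (inj₂ (eq , lt)) =
  ℤ.+-mono-≤ (ℤ.≤-reflexive (sym eq)) (⟦⟧-mono (k ≤? b) (k ≤? a) (λ k≤b → ℤ.≤-trans k≤b (ℤ.<⇒≤ lt)))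

-- Adding ω to b puts it above every level.
h-near : ∀ k a b → h k a ≤ h k b + 1ℤ
h-near k a b with a <? 0ℤ
... | no _ = ℤ.+-mono-≤ {0ℤ} {h k b} (ℤ.+-mono-≤ 0≤⟦ b <? 0ℤ ⟧ 0≤⟦ k ≤? b ⟧) ⟦ k ≤? a ⟧≤1
... | yes a<0 = ≡.subst (_≤ h k b + 1ℤ) (ℤ.+-comm ⟦ k ≤? a ⟧ 1ℤ) (ℤ.+-monoˡ-≤ 1ℤ le)
  where
  le : ⟦ k ≤? a ⟧ ≤ h k b
  le with b <? 0ℤ
  ... | yes _  = ℤ.≤-trans ⟦ k ≤? a ⟧≤1 (ℤ.+-monoʳ-≤ 1ℤ 0≤⟦ k ≤? b ⟧)
  ... | no b≮0 = ≡.subst (⟦ k ≤? a ⟧ ≤_) (sym (ℤ.+-identityˡ ⟦ k ≤? b ⟧))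
                   (⟦⟧-mono (k ≤? a) (k ≤? b) (λ k≤a → ℤ.≤-trans k≤a (ℤ.≤-trans (ℤ.<⇒≤ a<0) (ℤ.≮⇒≥ b≮0))))

-- The closed path of a word and its crossings of a level.

record Step : Set where
  constructor step
  field
    time   : ℕ
    letter : ℤ
    level  : ℤ

  source : ℤ
  source = level - letter

open Step

total : List ℤ → ℤ
total = ∑ (λ x → x)

-- The steps of the path of a word, from last to first, the word being given reversed.
steps : List ℤ → List Step
steps []      = []
steps (x ∷ r) = step (suc (length r)) x (x + total r) ∷ steps r

-- A step at time 0 from the end of the path back to level 0 closes it up; it comes last in sweep order.
start : List ℤ → Step
start r = step 0 (- total r) 0ℤ

closed : List ℤ → List Step
closed r = start r ∷ steps r

i+j-i≡j : ∀ i j → (i + j) - i ≡ j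
i+j-i≡j = solve-∀

0--i≡i : ∀ i → 0ℤ - - i ≡ i
0--i≡i = solve-∀

-- The closed path is cyclic: each step starts where its predecessor ended. The induction runs over
-- the open path, whose ends `0ℤ` and `total r` are the level and the source of the closing step.
∑-level-source : ∀ f r → ∑ (f ∘ level) (closed r) ≡ ∑ (f ∘ source) (closed r)
∑-level-source f r = begin
  f 0ℤ + ∑ (f ∘ level) (steps r)               ≡⟨ lemma r ⟩
  f (total r) + ∑ (f ∘ source) (steps r)       ≡⟨ cong (λ s → f s + ∑ (f ∘ source) (steps r)) (0--i≡i (total r)) ⟨
  f (0ℤ - - total r) + ∑ (f ∘ source) (steps r) ∎
  where
  open ≡-Reasoning
  lemma : ∀ r → f 0ℤ + ∑ (f ∘ level) (steps r) ≡ f (total r) + ∑ (f ∘ source) (steps r)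
  lemma []      = refl
  lemma (x ∷ r) = begin
    f 0ℤ + (f (x + total r) + ∑ (f ∘ level) (steps r))
      ≡⟨ left-comm (f 0ℤ) (f (x + total r)) _ ⟩
    f (x + total r) + (f 0ℤ + ∑ (f ∘ level) (steps r))
      ≡⟨ cong (λ s → f (x + total r) + s) (lemma r) ⟩
    f (x + total r) + (f (total r) + ∑ (f ∘ source) (steps r))
      ≡⟨ cong (λ s → f (x + total r) + (f s + ∑ (f ∘ source) (steps r))) (i+j-i≡j x (total r)) ⟨
    f (x + total r) + (f ((x + total r) - x) + ∑ (f ∘ source) (steps r)) ∎

-- The closing step puts the path at level 0 at time 0, so it counts as an arrival. It leaves
-- `total r` only after the last step of the word, so a departure must have positive time.
arrival departure : ℕ → ℤ → Step → ℤ
arrival   j k s = ⟦ time s ℕ.≤? j ×-dec level s ≟ k ⟧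
departure j k s = ⟦ 0 ℕ.<? time s ×-dec time s ℕ.≤? j ×-dec source s ≟ k ⟧

time-≤-length : ∀ r {s} → s ∈ steps r → time s ℕ.≤ length r
time-≤-length (x ∷ r) (here refl) = ℕ.≤-refl
time-≤-length (x ∷ r) (there s∈)  = ℕ.m≤n⇒m≤1+n (time-≤-length r s∈)

time-≢0 : ∀ r {s} → s ∈ steps r → time s ≢ 0
time-≢0 (_ ∷ r) (here refl) ()
time-≢0 (_ ∷ r) (there s∈)  = time-≢0 r s∈

time-0 : ∀ r {s} → s ∈ closed r → time s ≡ 0 → s ≡ start r
time-0 r (here refl) _   = refl
time-0 r (there s∈)  t≡0 = contradiction t≡0 (time-≢0 r s∈)

-- Each visit to `k` ends with a departure, except a visit at the very end of the path; each visit
-- begins with an arrival, except the one at the outset when `k` is 0.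
arrivals-departures : ∀ j k r → length r ℕ.≤ j →
  ∑ (departure j k) (steps r) + ⟦ total r ≟ k ⟧ ≡ ⟦ 0ℤ ≟ k ⟧ + ∑ (arrival j k) (steps r)
arrivals-departures j k []      _ = ℤ.+-comm 0ℤ ⟦ 0ℤ ≟ k ⟧
arrivals-departures j k (x ∷ r) l = begin
  (departure j k s + ∑ (departure j k) (steps r)) + ⟦ level s ≟ k ⟧
    ≡⟨ cong (λ d → (d + ∑ (departure j k) (steps r)) + ⟦ level s ≟ k ⟧) dep ⟩
  (⟦ total r ≟ k ⟧ + ∑ (departure j k) (steps r)) + ⟦ level s ≟ k ⟧
    ≡⟨ cong (_+ ⟦ level s ≟ k ⟧) (ℤ.+-comm ⟦ total r ≟ k ⟧ _) ⟩
  (∑ (departure j k) (steps r) + ⟦ total r ≟ k ⟧) + ⟦ level s ≟ k ⟧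
    ≡⟨ cong (_+ ⟦ level s ≟ k ⟧) (arrivals-departures j k r (ℕ.<⇒≤ l)) ⟩
  (⟦ 0ℤ ≟ k ⟧ + ∑ (arrival j k) (steps r)) + ⟦ level s ≟ k ⟧
    ≡⟨ cong (λ a → (⟦ 0ℤ ≟ k ⟧ + ∑ (arrival j k) (steps r)) + a) arr ⟨
  (⟦ 0ℤ ≟ k ⟧ + ∑ (arrival j k) (steps r)) + arrival j k s
    ≡⟨ rotate ⟦ 0ℤ ≟ k ⟧ (∑ (arrival j k) (steps r)) (arrival j k s) ⟩
  ⟦ 0ℤ ≟ k ⟧ + (arrival j k s + ∑ (arrival j k) (steps r)) ∎
  where
  open ≡-Reasoning
  s = step (suc (length r)) x (x + total r)
  rotate : ∀ a b c → (a + b) + c ≡ a + (c + b)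
  rotate = solve-∀
  dep : departure j k s ≡ ⟦ total r ≟ k ⟧
  dep = ⟦⟧-cong (0 ℕ.<? time s ×-dec time s ℕ.≤? j ×-dec source s ≟ k) (total r ≟ k)
          (λ (_ , _ , e) → ≡.trans (sym (i+j-i≡j x (total r))) e)
          (λ e → ℕ.s≤s ℕ.z≤n , l , ≡.trans (i+j-i≡j x (total r)) e)
  arr : arrival j k s ≡ ⟦ level s ≟ k ⟧
  arr = ⟦⟧-cong (time s ℕ.≤? j ×-dec level s ≟ k) (level s ≟ k) proj₂ (l ,_)

-- Right after `q` the path stands at `level q`, which it has reached once more often than it has
-- left. Steps later than `q` contribute to neither sum.
arrivals-departures-at : ∀ r {q} → q ∈ closed r → time q ≢ 0 →
  ∑ (departure (time q) (level q)) (closed r) + 1ℤ ≡ ∑ (arrival (time q) (level q)) (closed r)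
arrivals-departures-at r {q} (here refl) t≢0 = contradiction refl t≢0
arrivals-departures-at r {q} (there q∈)  _   = begin
  (departure j k (start r) + ∑ (departure j k) (steps r)) + 1ℤ
    ≡⟨ cong (λ d → (d + ∑ (departure j k) (steps r)) + 1ℤ) dep ⟩
  (0ℤ + ∑ (departure j k) (steps r)) + 1ℤ
    ≡⟨ cong (_+ 1ℤ) (ℤ.+-identityˡ (∑ (departure j k) (steps r))) ⟩
  ∑ (departure j k) (steps r) + 1ℤ
    ≡⟨ go r q∈ ⟩
  ⟦ 0ℤ ≟ k ⟧ + ∑ (arrival j k) (steps r)
    ≡⟨ cong (_+ ∑ (arrival j k) (steps r)) arr ⟨
  arrival j k (start r) + ∑ (arrival j k) (steps r) ∎
  where
  open ≡-Reasoning
  j = time q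
  k = level q
  dep : departure j k (start r) ≡ 0ℤ
  dep = ⟦⟧-false (0 ℕ.<? 0 ×-dec 0 ℕ.≤? j ×-dec source (start r) ≟ k) (λ ())
  arr : arrival j k (start r) ≡ ⟦ 0ℤ ≟ k ⟧
  arr = ⟦⟧-cong (0 ℕ.≤? j ×-dec 0ℤ ≟ k) (0ℤ ≟ k) proj₂ (ℕ.z≤n ,_)
  go : ∀ r → q ∈ steps r → ∑ (departure j k) (steps r) + 1ℤ ≡ ⟦ 0ℤ ≟ k ⟧ + ∑ (arrival j k) (steps r)
  go (x ∷ r) (here refl) = ≡.trans
    (cong (λ i → ∑ (departure j k) (steps (x ∷ r)) + i) (sym (⟦⟧-true (total (x ∷ r) ≟ k) refl)))
    (arrivals-departures j k (x ∷ r) ℕ.≤-refl)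
  go (x ∷ r) (there q∈) = begin
    (departure j k s + ∑ (departure j k) (steps r)) + 1ℤ
      ≡⟨ cong (λ d → (d + ∑ (departure j k) (steps r)) + 1ℤ)
           (⟦⟧-false (0 ℕ.<? time s ×-dec time s ℕ.≤? j ×-dec source s ≟ k) (λ (_ , t≤j , _) → s≰ t≤j)) ⟩
    (0ℤ + ∑ (departure j k) (steps r)) + 1ℤ
      ≡⟨ cong (_+ 1ℤ) (ℤ.+-identityˡ (∑ (departure j k) (steps r))) ⟩
    ∑ (departure j k) (steps r) + 1ℤ
      ≡⟨ go r q∈ ⟩
    ⟦ 0ℤ ≟ k ⟧ + ∑ (arrival j k) (steps r)
      ≡⟨ cong (λ i → ⟦ 0ℤ ≟ k ⟧ + i) (ℤ.+-identityˡ _) ⟨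
    ⟦ 0ℤ ≟ k ⟧ + (0ℤ + ∑ (arrival j k) (steps r))
      ≡⟨ cong (λ i → ⟦ 0ℤ ≟ k ⟧ + (i + ∑ (arrival j k) (steps r)))
           (⟦⟧-false (time s ℕ.≤? j ×-dec level s ≟ k) (λ (t≤j , _) → s≰ t≤j)) ⟨
    ⟦ 0ℤ ≟ k ⟧ + (arrival j k s + ∑ (arrival j k) (steps r)) ∎
    where
    s = step (suc (length r)) x (x + total r)
    s≰ : ¬ (time s ℕ.≤ j)
    s≰ t≤j = ℕ.<⇒≱ (ℕ.s≤s (time-≤-length r q∈)) t≤j

-- The order in which the sweep lists steps. It reads from right to left, so within a level the
-- later step comes first.
_▷_ : Step → Step → Set
a ▷ b = level a ≻ level b ⊎ (level a ≡ level b × time b ℕ.< time a)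

≻-irrefl : ∀ {a} → ¬ (a ≻ a)
≻-irrefl (inj₁ lt)       = ℤ.<-irrefl refl lt
≻-irrefl (inj₂ (_ , lt)) = ℤ.<-irrefl refl lt

▷-irrefl : ∀ {a} → ¬ (a ▷ a)
▷-irrefl (inj₁ lt)       = ≻-irrefl lt
▷-irrefl (inj₂ (_ , lt)) = ℕ.<-irrefl refl lt

h-mono-▷ : ∀ k {a b} → a ▷ b → h k (level b) ≤ h k (level a)
h-mono-▷ k (inj₁ a≻b)      = h-mono k a≻b
h-mono-▷ k (inj₂ (eq , _)) = ℤ.≤-reflexive (cong (h k) (sym eq))

-- Comparing the levels of two words with the same sweep.

private
  cross-≤ : ∀ p p′ q q′ → (q + p′) - (q′ + p) ≡ (q - q′) - (p - p′)
  cross-≤ = solve-∀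

  difference-≤ : ∀ {p p′ q q′} → p - p′ ≤ q - q′ → q′ + p ≤ q + p′
  difference-≤ {p} {p′} {q} {q′} le = ≤-by le (cross-≤ p p′ q q′)

  difference-≡ : ∀ {p p′ q q′} → p - p′ ≡ q - q′ → q′ + p ≡ q + p′
  difference-≡ {p} {p′} {q} {q′} eq = ℤ.≤-antisym
    (difference-≤ {p} {p′} {q} {q′} (ℤ.≤-reflexive eq))
    (≡.subst₂ _≤_ (ℤ.+-comm p′ q) (ℤ.+-comm p q′) (difference-≤ {q} {q′} {p} {p′} (ℤ.≤-reflexive (sym eq))))

  difference-< : ∀ {p p′ q q′} → p - p′ < q - q′ → q′ + p < q + p′
  difference-< {p} {p′} {q} {q′} lt = ℤ.≤∧≢⇒< (difference-≤ {p} {p′} {q} {q′} (ℤ.<⇒≤ lt))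
    λ eq → ℤ.<⇒≢ lt (ℤ.i-j≡0⇒i≡j _ _ (≡.trans (flip p p′ q q′) (ℤ.i≡j⇒i-j≡0 eq)))
    where
    flip : ∀ p p′ q q′ → (p - p′) - (q - q′) ≡ (q′ + p) - (q + p′)
    flip = solve-∀

  -- If the difference at `p` is at most that at `q`, then `p` above `q` forces `p′` above `q′`. The
  -- extra unit in the conclusion may come from strictness of either hypothesis: `a` and `c` record
  -- which.
  transfer : ∀ {p p′ q q′} a c → a + (p - p′) ≤ q - q′ → c + q ≤ p → (a + c) + q′ ≤ p′
  transfer {p} {p′} {q} {q′} a c le le′ = ≤-by (ℤ.+-mono-≤ le le′) (identity a c p p′ q q′)
    where
    identity : ∀ a c p p′ q q′ → p′ - ((a + c) + q′) ≡ ((q - q′) + p) - ((a + (p - p′)) + (c + q))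
    identity = solve-∀

  transfer-≤ : ∀ {p p′ q q′} → p - p′ ≤ q - q′ → 1ℤ + q ≤ p → 1ℤ + q′ ≤ p′
  transfer-≤ {p} {p′} {q} {q′} le =
    transfer {p} {p′} {q} {q′} 0ℤ 1ℤ (subst (_≤ q - q′) (sym (ℤ.+-identityˡ (p - p′))) le)

  transfer-< : ∀ {p p′ q q′} → p - p′ < q - q′ → q ≤ p → 1ℤ + q′ ≤ p′
  transfer-< {p} {p′} {q} {q′} lt le =
    transfer {p} {p′} {q} {q′} 1ℤ 0ℤ (ℤ.i<j⇒suc[i]≤j lt) (subst (_≤ p) (sym (ℤ.+-identityˡ q)) le)

  source-difference : ∀ a b x → (a - x) - (b - x) ≡ a - b
  source-difference = solve-∀

  difference-<0 : ∀ {p p′} → p - p′ < 0ℤ → p < p′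
  difference-<0 {p} {p′} lt =
    ≡.subst₂ _<_ (ℤ.+-identityˡ p) (ℤ.+-identityˡ p′) (difference-< {p} {p′} {0ℤ} {0ℤ} lt)

  swap-differences : ∀ {p p′ q q′} → p - p′ ≡ q - q′ → p′ - p ≡ q′ - q
  swap-differences {p} {p′} {q} {q′} eq = begin
    p′ - p       ≡⟨ negate p p′ ⟩
    - (p - p′)   ≡⟨ cong -_ eq ⟩
    - (q - q′)   ≡⟨ negate q q′ ⟨
    q′ - q       ∎
    where
    open ≡-Reasoning
    negate : ∀ p p′ → p′ - p ≡ - (p - p′)
    negate = solve-∀

-- A position `z` of the common sweep carries the step `π z` of one word and `π′ z` of the other;
-- `z₀` carries both closing steps. The outcome bounds the levels under `π` by those under `π′`, and
-- exchanging the words gives the reverse bound.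
module Comparison
  {A : Set} (Z : List A) (π π′ : A → Step) (r r′ : List ℤ)
  (Z↭ : map π Z ↭ closed r) (Z↭′ : map π′ Z ↭ closed r′)
  (letters : ∀ {z} → z ∈ Z → letter (π z) ≡ letter (π′ z))
  (sorted : AllPairs (λ a b → π a ▷ π b × π′ a ▷ π′ b) Z)
  {z₀ : A} (z₀∈ : z₀ ∈ Z) (z₀≡ : π z₀ ≡ start r) (z₀≡′ : π′ z₀ ≡ start r′)
  where

  ℓ ℓ′ : A → ℤ
  ℓ  = level ∘ π
  ℓ′ = level ∘ π′

  -- The ω-part and the integer part of the difference of the two levels, to be compared by `≼`.
  D : A → ℤ × ℤ
  D z = ε (ℓ z) - ε (ℓ′ z) , ℓ z - ℓ′ z

  -- Only the threshold indicator moves from levels to sources, by `∑-level-source`. The `ε` part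
  -- stays at the level: equal letters make the sources differ by as much as the levels, but give no
  -- such control over `ε` of the sources.
  transport : ∀ (ρ : A → Step) s → map ρ Z ↭ closed s → ∀ c k →
    ∑ (λ z → c + h k (level (ρ z))) Z ≡ ∑ (λ z → c + (ε (level (ρ z)) + ⟦ k ≤? source (ρ z) ⟧)) Z
  transport ρ s Z↭s c k = begin
    ∑ (λ z → c + (e z + f (level (ρ z)))) Z      ≡⟨ split (f ∘ level) ⟩
    ∑ (λ z → c + e z) Z + ∑ (f ∘ level ∘ ρ) Z    ≡⟨ cong (∑ (λ z → c + e z) Z +_) same ⟩
    ∑ (λ z → c + e z) Z + ∑ (f ∘ source ∘ ρ) Z   ≡⟨ split (f ∘ source) ⟨
    ∑ (λ z → c + (e z + f (source (ρ z)))) Z     ∎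
    where
    open ≡-Reasoning
    e : A → ℤ
    e z = ε (level (ρ z))
    f : ℤ → ℤ
    f a = ⟦ k ≤? a ⟧
    split : ∀ (g : Step → ℤ) → ∑ (λ z → c + (e z + g (ρ z))) Z ≡ ∑ (λ z → c + e z) Z + ∑ (g ∘ ρ) Z
    split g = ≡.trans (∑-cong Z (λ {z} _ → sym (ℤ.+-assoc c (e z) (g (ρ z))))) (∑-+ (λ z → c + e z) (g ∘ ρ) Z)
    same : ∑ (f ∘ level ∘ ρ) Z ≡ ∑ (f ∘ source ∘ ρ) Z
    same = begin
      ∑ (f ∘ level ∘ ρ) Z          ≡⟨ ∑-map (f ∘ level) ρ Z ⟨
      ∑ (f ∘ level) (map ρ Z)      ≡⟨ ∑-↭ (f ∘ level) Z↭s ⟩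
      ∑ (f ∘ level) (closed s)     ≡⟨ ∑-level-source f s ⟩
      ∑ (f ∘ source) (closed s)    ≡⟨ ∑-↭ (f ∘ source) Z↭s ⟨
      ∑ (f ∘ source) (map ρ Z)     ≡⟨ ∑-map (f ∘ source) ρ Z ⟩
      ∑ (f ∘ source ∘ ρ) Z         ∎

  module _ {q} (q∈ : q ∈ Z) (maximal : ∀ {z} → z ∈ Z → D z ≼ D q) where

    -- k is the threshold K for ℓ′ shifted by D q - 1: up to the ω-part, k ≤ ℓ′ z iff K ≤ ℓ′ z + (ℓ q - ℓ′ q) - 1.
    K k e e′ : ℤ
    K  = ℓ q
    k  = 1ℤ + ℓ′ q
    e  = ε (ℓ q)
    e′ = ε (ℓ′ q)

    S? : ∀ z → Dec (D z ≡ D q)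
    S? z = ≡-dec _≟_ _≟_ (D z) (D q)

    into out : A → ℤ
    into z = ⟦ S? z ×-dec ℓ z ≟ K ⟧
    out  z = ⟦ S? z ×-dec source (π z) ≟ K ⟧

    S-ε : ∀ {z} → D z ≡ D q → e′ + ε (ℓ z) ≡ e + ε (ℓ′ z)
    S-ε {z} s = difference-≡ {ε (ℓ z)} {ε (ℓ′ z)} {e} {e′} (cong proj₁ s)

    src-difference : ∀ {z} → z ∈ Z → source (π z) - source (π′ z) ≡ ℓ z - ℓ′ z
    src-difference {z} z∈ = ≡.trans (cong (λ x → source (π z) - (ℓ′ z - x)) (sym (letters z∈)))
                                    (source-difference (ℓ z) (ℓ′ z) (letter (π z)))

    h-K-q : h K K ≡ e + 1ℤ
    h-K-q = cong (e +_) (⟦⟧-true (K ≤? K) ℤ.≤-refl)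

    h-k-q : h k (ℓ′ q) ≡ e′
    h-k-q = ≡.trans (cong (e′ +_) (⟦⟧-false (k ≤? ℓ′ q) (λ k≤ → ℤ.<-irrefl refl (ℤ.suc[i]≤j⇒i<j k≤))))
                    (ℤ.+-identityʳ e′)

    -- With `ℓ` fixed at `K`, `D` varies only through `ℓ′`, which decreases along the sweep and
    -- enters with a minus sign.
    D-antitone : ∀ {z} → ℓ z ≡ K → π′ q ▷ π′ z → D q ≼ D z
    D-antitone {z} ℓ≡ q▷z rewrite ℓ≡ = go q▷z
      where
      go : π′ q ▷ π′ z → D q ≼ (e - ε (ℓ′ z) , K - ℓ′ z)
      go (inj₁ (inj₁ lt))        = inj₁ (ℤ.+-monoʳ-< e (ℤ.neg-mono-< lt))
      go (inj₁ (inj₂ (eq , lt))) = inj₂ (cong (λ i → e - i) eq , ℤ.+-monoʳ-≤ K (ℤ.neg-mono-≤ (ℤ.<⇒≤ lt)))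
      go (inj₂ (eq , _))         = inj₂ (cong (λ a → e - ε a) eq , ℤ.≤-reflexive (cong (λ a → K - a) eq))

    -- In S the ω-parts on both sides agree, and `k ≤ ℓ′ z` means `K < ℓ z`. The remaining case
    -- `ℓ z ≡ K` of the right-hand indicator pays for `into z`.
    level-bound-∈ : ∀ {z} → D z ≡ D q → into z + (e + h k (ℓ′ z)) ≤ e′ + h K (ℓ z)
    level-bound-∈ {z} s = begin
      into z + (e + h k (ℓ′ z))             ≡⟨ regroup (into z) e (ε (ℓ′ z)) ⟦ k ≤? ℓ′ z ⟧ ⟩
      (e + ε (ℓ′ z)) + (into z + ⟦ k ≤? ℓ′ z ⟧)
                                            ≤⟨ ℤ.+-monoʳ-≤ (e + ε (ℓ′ z)) indicators ⟩
      (e + ε (ℓ′ z)) + ⟦ K ≤? ℓ z ⟧         ≡⟨ cong (_+ ⟦ K ≤? ℓ z ⟧) (S-ε s) ⟨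
      (e′ + ε (ℓ z)) + ⟦ K ≤? ℓ z ⟧         ≡⟨ ℤ.+-assoc e′ (ε (ℓ z)) ⟦ K ≤? ℓ z ⟧ ⟩
      e′ + h K (ℓ z)                        ∎
      where
      open ℤ.≤-Reasoning
      regroup : ∀ a b c d → a + (b + (c + d)) ≡ (b + c) + (a + d)
      regroup = solve-∀
      indicators : into z + ⟦ k ≤? ℓ′ z ⟧ ≤ ⟦ K ≤? ℓ z ⟧
      indicators with k ≤? ℓ′ z
      ... | no _    = subst (_≤ ⟦ K ≤? ℓ z ⟧) (sym (ℤ.+-identityʳ (into z)))
                        (⟦⟧-mono (S? z ×-dec ℓ z ≟ K) (K ≤? ℓ z) (ℤ.≤-reflexive ∘ sym ∘ proj₂))
      ... | yes k≤  = ℤ.≤-reflexive (≡.trans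
                        (cong (_+ 1ℤ) (⟦⟧-false (S? z ×-dec ℓ z ≟ K) (λ (_ , eq) → ℤ.<-irrefl (sym eq) K<)))
                        (sym (⟦⟧-true (K ≤? ℓ z) (ℤ.<⇒≤ K<))))
                      where
                      K< : K < ℓ z
                      K< = ℤ.suc[i]≤j⇒i<j (transfer-≤ {ℓ′ z} {ℓ z} {ℓ′ q} {K}
                             (ℤ.≤-reflexive (swap-differences {ℓ z} {ℓ′ z} {K} {ℓ′ q} (cong proj₂ s))) k≤)

    -- Both sides are compared with their values at `q`. If `z` precedes `q` in the sweep, e + e′ +
    -- 1 separates them; if it follows `q`, e + e′ does.
    level-bound-∉ : ∀ {z} → z ∈ Z → D z ≢ D q → into z + (e + h k (ℓ′ z)) ≤ e′ + h K (ℓ z)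
    level-bound-∉ {z} z∈ ¬s = begin
      into z + (e + h k (ℓ′ z))   ≡⟨ cong (_+ (e + h k (ℓ′ z))) (⟦⟧-false (S? z ×-dec ℓ z ≟ K) (¬s ∘ proj₁)) ⟩
      0ℤ + (e + h k (ℓ′ z))       ≡⟨ ℤ.+-identityˡ (e + h k (ℓ′ z)) ⟩
      e + h k (ℓ′ z)              ≤⟨ compare (AllPairs-compare sorted z∈ q∈) ⟩
      e′ + h K (ℓ z)              ∎
      where
      open ℤ.≤-Reasoning
      compare : z ≡ q ⊎ (π z ▷ π q × π′ z ▷ π′ q) ⊎ (π q ▷ π z × π′ q ▷ π′ z) → e + h k (ℓ′ z) ≤ e′ + h K (ℓ z)
      compare (inj₁ z≡q)                 = contradiction (cong D z≡q) ¬s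
      compare (inj₂ (inj₁ (z▷q , _)))    = begin
        e + h k (ℓ′ z)              ≤⟨ ℤ.+-monoʳ-≤ e (h-near k (ℓ′ z) (ℓ′ q)) ⟩
        e + (h k (ℓ′ q) + 1ℤ)       ≡⟨ cong (λ i → e + (i + 1ℤ)) h-k-q ⟩
        e + (e′ + 1ℤ)               ≡⟨ left-comm e e′ 1ℤ ⟩
        e′ + (e + 1ℤ)               ≡⟨ cong (e′ +_) h-K-q ⟨
        e′ + h K K                  ≤⟨ ℤ.+-monoʳ-≤ e′ (h-mono-▷ K {π z} {π q} z▷q) ⟩
        e′ + h K (ℓ z)              ∎
      compare (inj₂ (inj₂ (_ , q▷z)))    = begin
        e + h k (ℓ′ z)              ≤⟨ ℤ.+-monoʳ-≤ e (h-mono-▷ k {π′ q} {π′ z} q▷z) ⟩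
        e + h k (ℓ′ q)              ≡⟨ cong (e +_) h-k-q ⟩
        e + e′                      ≡⟨ ℤ.+-comm e e′ ⟩
        e′ + e                      ≤⟨ ℤ.+-monoʳ-≤ e′ e≤ ⟩
        e′ + h K (ℓ z)              ∎
        where
        cancel-1 : ∀ a b → b - a ≡ (b + 1ℤ) - (a + 1ℤ)
        cancel-1 = solve-∀
        e≤ : e ≤ h K (ℓ z)
        e≤ = ≤-by (subst (_≤ h K (ℓ z) + 1ℤ) h-K-q (h-near K K (ℓ z))) (cancel-1 e (h K (ℓ z)))

    level-bound : ∀ {z} → z ∈ Z → into z + (e + h k (ℓ′ z)) ≤ e′ + h K (ℓ z)
    level-bound {z} z∈ = [ level-bound-∈ , level-bound-∉ z∈ ]′ (toSum (S? z))

    -- Again the ω-parts agree. A source strictly above `K` has its counterpart at `k` or above, and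
    -- a source equal to `K` is paid for by `out z`.
    source-bound-∈ : ∀ {z} → z ∈ Z → D z ≡ D q →
      e′ + (ε (ℓ z) + ⟦ K ≤? source (π z) ⟧) ≤ (e + (ε (ℓ′ z) + ⟦ k ≤? source (π′ z) ⟧)) + out z
    source-bound-∈ {z} z∈ s = begin
      e′ + (ε (ℓ z) + ⟦ K ≤? src ⟧)                  ≡⟨ ℤ.+-assoc e′ (ε (ℓ z)) ⟦ K ≤? src ⟧ ⟨
      (e′ + ε (ℓ z)) + ⟦ K ≤? src ⟧                  ≡⟨ cong (_+ ⟦ K ≤? src ⟧) (S-ε s) ⟩
      (e + ε (ℓ′ z)) + ⟦ K ≤? src ⟧                  ≤⟨ ℤ.+-monoʳ-≤ (e + ε (ℓ′ z)) indicators ⟩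
      (e + ε (ℓ′ z)) + (⟦ k ≤? src′ ⟧ + out z)       ≡⟨ regroup e (ε (ℓ′ z)) ⟦ k ≤? src′ ⟧ (out z) ⟩
      (e + (ε (ℓ′ z) + ⟦ k ≤? src′ ⟧)) + out z       ∎
      where
      open ℤ.≤-Reasoning
      src  = source (π z)
      src′ = source (π′ z)
      regroup : ∀ a b c d → (a + b) + (c + d) ≡ (a + (b + c)) + d
      regroup = solve-∀
      indicators : ⟦ K ≤? src ⟧ ≤ ⟦ k ≤? src′ ⟧ + out z
      indicators = [ equal , different ]′ (toSum (src ≟ K))
        where
        equal : src ≡ K → ⟦ K ≤? src ⟧ ≤ ⟦ k ≤? src′ ⟧ + out z
        equal eq = begin
          ⟦ K ≤? src ⟧              ≤⟨ ⟦ K ≤? src ⟧≤1 ⟩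
          0ℤ + 1ℤ                   ≤⟨ ℤ.+-monoˡ-≤ 1ℤ 0≤⟦ k ≤? src′ ⟧ ⟩
          ⟦ k ≤? src′ ⟧ + 1ℤ        ≡⟨ cong (⟦ k ≤? src′ ⟧ +_) (⟦⟧-true (S? z ×-dec src ≟ K) (s , eq)) ⟨
          ⟦ k ≤? src′ ⟧ + out z     ∎
        different : src ≢ K → ⟦ K ≤? src ⟧ ≤ ⟦ k ≤? src′ ⟧ + out z
        different neq = begin
          ⟦ K ≤? src ⟧              ≤⟨ ⟦⟧-mono (K ≤? src) (k ≤? src′) (λ K≤ → transfer-≤ {src} {src′} {K} {ℓ′ q}
                                         (ℤ.≤-reflexive (≡.trans (src-difference z∈) (cong proj₂ s)))
                                         (ℤ.i<j⇒suc[i]≤j (ℤ.≤∧≢⇒< K≤ (neq ∘ sym)))) ⟩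
          ⟦ k ≤? src′ ⟧             ≡⟨ ℤ.+-identityʳ ⟦ k ≤? src′ ⟧ ⟨
          ⟦ k ≤? src′ ⟧ + 0ℤ        ≤⟨ ℤ.+-monoʳ-≤ ⟦ k ≤? src′ ⟧ 0≤⟦ S? z ×-dec src ≟ K ⟧ ⟩
          ⟦ k ≤? src′ ⟧ + out z     ∎

    -- Here `D z` lies strictly below `D q`. A drop in the ω-part absorbs the indicator; a drop in
    -- the integer part turns `K ≤ src` into `k ≤ src′`.
    source-bound-∉ : ∀ {z} → z ∈ Z → D z ≢ D q →
      e′ + (ε (ℓ z) + ⟦ K ≤? source (π z) ⟧) ≤ (e + (ε (ℓ′ z) + ⟦ k ≤? source (π′ z) ⟧)) + out z
    source-bound-∉ {z} z∈ ¬s = begin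
      e′ + (ε (ℓ z) + ⟦ K ≤? src ⟧)                  ≡⟨ ℤ.+-assoc e′ (ε (ℓ z)) ⟦ K ≤? src ⟧ ⟨
      (e′ + ε (ℓ z)) + ⟦ K ≤? src ⟧                  ≤⟨ weights (maximal z∈) ⟩
      (e + ε (ℓ′ z)) + ⟦ k ≤? src′ ⟧                 ≡⟨ ℤ.+-assoc e (ε (ℓ′ z)) ⟦ k ≤? src′ ⟧ ⟩
      e + (ε (ℓ′ z) + ⟦ k ≤? src′ ⟧)                 ≡⟨ ℤ.+-identityʳ (e + (ε (ℓ′ z) + ⟦ k ≤? src′ ⟧)) ⟨
      (e + (ε (ℓ′ z) + ⟦ k ≤? src′ ⟧)) + 0ℤ          ≤⟨ ℤ.+-monoʳ-≤ (e + (ε (ℓ′ z) + ⟦ k ≤? src′ ⟧)) 0≤⟦ S? z ×-dec src ≟ K ⟧ ⟩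
      (e + (ε (ℓ′ z) + ⟦ k ≤? src′ ⟧)) + out z       ∎
      where
      open ℤ.≤-Reasoning
      src  = source (π z)
      src′ = source (π′ z)
      weights : D z ≼ D q → (e′ + ε (ℓ z)) + ⟦ K ≤? src ⟧ ≤ (e + ε (ℓ′ z)) + ⟦ k ≤? src′ ⟧
      weights (inj₁ lt)        = shift-≤ _ _ (difference-< {ε (ℓ z)} {ε (ℓ′ z)} {e} {e′} lt) ⟦ K ≤? src ⟧≤1 0≤⟦ k ≤? src′ ⟧
      weights (inj₂ (eq , le)) = ℤ.+-mono-≤
        (ℤ.≤-reflexive (difference-≡ {ε (ℓ z)} {ε (ℓ′ z)} {e} {e′} eq))
        (⟦⟧-mono (K ≤? src) (k ≤? src′) (transfer-< {src} {src′} {K} {ℓ′ q}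
          (subst (_< K - ℓ′ q) (sym (src-difference z∈)) (ℤ.≤∧≢⇒< le (λ eq′ → ¬s (cong₂ _,_ eq eq′))))))

    source-bound : ∀ {z} → z ∈ Z →
      e′ + (ε (ℓ z) + ⟦ K ≤? source (π z) ⟧) ≤ (e + (ε (ℓ′ z) + ⟦ k ≤? source (π′ z) ⟧)) + out z
    source-bound {z} z∈ = [ source-bound-∈ z∈ , source-bound-∉ z∈ ]′ (toSum (S? z))

    -- Sum `level-bound`, pass to sources under `π`, sum `source-bound`, and return to levels under
    -- `π′`: the same sum `V` then stands on both sides and cancels.
    into≤out : ∑ into Z ≤ ∑ out Z
    into≤out = cancel (begin
      ∑ into Z + V
        ≡⟨ ∑-+ into (λ z → e + h k (ℓ′ z)) Z ⟨
      ∑ (λ z → into z + (e + h k (ℓ′ z))) Z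
        ≤⟨ ∑-mono Z level-bound ⟩
      ∑ (λ z → e′ + h K (ℓ z)) Z
        ≡⟨ transport π r Z↭ e′ K ⟩
      ∑ (λ z → e′ + (ε (ℓ z) + ⟦ K ≤? source (π z) ⟧)) Z
        ≤⟨ ∑-mono Z source-bound ⟩
      ∑ (λ z → (e + (ε (ℓ′ z) + ⟦ k ≤? source (π′ z) ⟧)) + out z) Z
        ≡⟨ ∑-+ (λ z → e + (ε (ℓ′ z) + ⟦ k ≤? source (π′ z) ⟧)) out Z ⟩
      ∑ (λ z → e + (ε (ℓ′ z) + ⟦ k ≤? source (π′ z) ⟧)) Z + ∑ out Z
        ≡⟨ cong (_+ ∑ out Z) (transport π′ r′ Z↭′ e k) ⟨
      V + ∑ out Z
        ∎)
      where
      open ℤ.≤-Reasoning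
      V = ∑ (λ z → e + h k (ℓ′ z)) Z
      swap-cancel : ∀ a b v → b - a ≡ (v + b) - (a + v)
      swap-cancel = solve-∀
      cancel : ∑ into Z + V ≤ V + ∑ out Z → ∑ into Z ≤ ∑ out Z
      cancel le = ≤-by le (swap-cancel (∑ into Z) (∑ out Z) V)

    module _ (latest : ∀ {z} → z ∈ Z → D z ≡ D q → time (π z) ℕ.≤ time (π q))
             (apart : ∀ {z} → z ∈ Z → D z ≡ D q → time (π z) ≢ 0) where

      -- A step ending at `K` no later than `q` is `q` itself or comes after it in the sweep. There
      -- `D` is at least `D q`, so by maximality it equals `D q`.
      arrival≤into : ∀ {z} → z ∈ Z → arrival (time (π q)) K (π z) ≤ into z
      arrival≤into {z} z∈ = ⟦⟧-mono (time (π z) ℕ.≤? time (π q) ×-dec ℓ z ≟ K) (S? z ×-dec ℓ z ≟ K)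
        λ (t≤ , ℓ≡) → S t≤ ℓ≡ , ℓ≡
        where
        S : time (π z) ℕ.≤ time (π q) → ℓ z ≡ K → D z ≡ D q
        S t≤ ℓ≡ with AllPairs-compare sorted z∈ q∈
        ... | inj₁ z≡q = cong D z≡q
        ... | inj₂ (inj₁ (inj₁ z≻q , _))        = contradiction (subst (_≻ K) ℓ≡ z≻q) (≻-irrefl {K})
        ... | inj₂ (inj₁ (inj₂ (_ , q<z) , _))  = contradiction t≤ (ℕ.<⇒≱ q<z)
        ... | inj₂ (inj₂ (_ , q▷z))             = ≼-antisym (maximal z∈) (D-antitone ℓ≡ q▷z)

      out≤departure : ∀ {z} → z ∈ Z → out z ≤ departure (time (π q)) K (π z)
      out≤departure {z} z∈ = ⟦⟧-mono (S? z ×-dec source (π z) ≟ K)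
        (0 ℕ.<? time (π z) ×-dec time (π z) ℕ.≤? time (π q) ×-dec source (π z) ≟ K)
        λ (s , src≡) → ℕ.n≢0⇒n>0 (apart z∈ s) , latest z∈ s , src≡

      -- Up to the time of `q`, arrivals at `K` are bounded by `into`, hence by `out`, hence by
      -- departures from `K`; yet they exceed these departures by one.
      impossible : ⊥
      impossible = ℤ.<-irrefl refl (ℤ.suc[i]≤j⇒i<j (begin
        1ℤ + ∑ dep (closed r)          ≡⟨ ℤ.+-comm 1ℤ (∑ dep (closed r)) ⟩
        ∑ dep (closed r) + 1ℤ          ≡⟨ arrivals-departures-at r (∈-resp-↭ Z↭ (∈-map⁺ π q∈)) (apart q∈ refl) ⟩
        ∑ arr (closed r)               ≡⟨ ∑-↭ arr Z↭ ⟨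
        ∑ arr (map π Z)                ≡⟨ ∑-map arr π Z ⟩
        ∑ (arr ∘ π) Z                  ≤⟨ ∑-mono Z arrival≤into ⟩
        ∑ into Z                       ≤⟨ into≤out ⟩
        ∑ out Z                        ≤⟨ ∑-mono Z out≤departure ⟩
        ∑ (dep ∘ π) Z                  ≡⟨ ∑-map dep π Z ⟨
        ∑ dep (map π Z)                ≡⟨ ∑-↭ dep Z↭ ⟩
        ∑ dep (closed r)               ∎))
        where
        open ℤ.≤-Reasoning
        dep = departure (time (π q)) K
        arr = arrival (time (π q)) K

  -- Take `q` latest among the positions where `D` is maximal. The closing position has difference
  -- 0, so a nonzero maximum would keep it out of S and `impossible` would apply.
  D≼0 : ∀ {z} → z ∈ Z → D z ≼ (0ℤ , 0ℤ)
  D≼0 {z} z∈ with maximum (λ a b → ≼-total (D a) (D b)) ≼-trans z₀∈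
  ... | m , m∈ , max with maximum (λ a b → ℕ.≤-total (time (π a)) (time (π b))) ℕ.≤-trans
                            (∈-filter⁺ (λ a → ≡-dec _≟_ _≟_ (D a) (D m)) m∈ refl)
  ... | q , q∈F , late with ∈-filter⁻ (λ a → ≡-dec _≟_ _≟_ (D a) (D m)) q∈F
  ... | q∈ , Dq≡Dm with ≡-dec _≟_ _≟_ (D q) (0ℤ , 0ℤ)
  ... | yes Dq≡0 = subst (D z ≼_) (≡.trans (sym Dq≡Dm) Dq≡0) (max z∈)
  ... | no  Dq≢0 = ⊥-elim (impossible q∈ (λ {a} a∈ → subst (D a ≼_) (sym Dq≡Dm) (max a∈))
    (λ a∈ Da≡Dq → late (∈-filter⁺ _ a∈ (≡.trans Da≡Dq Dq≡Dm)))
    (λ a∈ Da≡Dq t≡0 → Dq≢0 (≡.trans (sym Da≡Dq) (≡.trans (cong D (only a∈ t≡0)) D-z₀))))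
    where
    D-z₀ : D z₀ ≡ (0ℤ , 0ℤ)
    D-z₀ = cong₂ (λ a b → ε (level a) - ε (level b) , level a - level b) z₀≡ z₀≡′
    πa≡πz₀ : ∀ {a} → a ∈ Z → time (π a) ≡ 0 → π a ≡ π z₀
    πa≡πz₀ a∈ t≡0 = ≡.trans (time-0 r (∈-resp-↭ Z↭ (∈-map⁺ π a∈)) t≡0) (sym z₀≡)
    -- Since `▷` is irreflexive, sortedness makes `π` injective on `Z`.
    only : ∀ {a} → a ∈ Z → time (π a) ≡ 0 → a ≡ z₀
    only {a} a∈ t≡0 with AllPairs-compare sorted a∈ z₀∈
    ... | inj₁ a≡z₀              = a≡z₀
    ... | inj₂ (inj₁ (a▷z₀ , _)) = contradiction (subst (_▷ π z₀) (πa≡πz₀ a∈ t≡0) a▷z₀) (▷-irrefl {π z₀})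
    ... | inj₂ (inj₂ (z₀▷a , _)) = contradiction (subst (π z₀ ▷_) (πa≡πz₀ a∈ t≡0) z₀▷a) (▷-irrefl {π z₀})

  level-≼ : ∀ {z} → z ∈ Z → (ε (ℓ z) , ℓ z) ≼ (ε (ℓ′ z) , ℓ′ z)
  level-≼ {z} z∈ with D≼0 z∈
  ... | inj₁ lt        = inj₁ (difference-<0 lt)
  ... | inj₂ (eq , le) = inj₂ (ℤ.i-j≡0⇒i≡j (ε (ℓ z)) (ε (ℓ′ z)) eq , ℤ.i-j≤0⇒i≤j le)

-- The sweep as a stable sort of the steps by level.

filter-map : ∀ {P : B → Set} (P? : Decidable P) (f : A → B) xs →
  filter P? (map f xs) ≡ map f (filter (P? ∘ f) xs)
filter-map P? f []       = refl
filter-map P? f (x ∷ xs) with P? (f x)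
... | yes _ = cong (f x ∷_) (filter-map P? f xs)
... | no  _ = filter-map P? f xs

at : ℤ → List Step → List Step
at k = filter (λ s → level s ≟ k)

swept : List ℤ → List Step → List Step
swept ks E = concatMap (λ k → at k E) ks

≻⇒≢ : ∀ {a b} → a ≻ b → a ≢ b
≻⇒≢ {a} a≻a refl = ≻-irrefl {a} a≻a

swept-∷-∉ : ∀ ks {s E} → All (level s ≢_) ks → swept ks (s ∷ E) ≡ swept ks E
swept-∷-∉ []       _          = refl
swept-∷-∉ (k ∷ ks) (≢k ∷ ≢ks) = cong₂ _++_ (List.filter-reject (λ s → level s ≟ k) ≢k) (swept-∷-∉ ks ≢ks)

swept-∷ : ∀ {ks s E} → AllPairs _≻_ ks → level s ∈ ks → swept ks (s ∷ E) ↭ s ∷ swept ks E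
swept-∷ {k ∷ ks} {s} {E} (k≻ ∷ _) (here refl) = ↭-reflexive
  (cong₂ _++_ (List.filter-accept (λ s → level s ≟ k) refl) (swept-∷-∉ ks (All.map ≻⇒≢ k≻)))
swept-∷ {k ∷ ks} {s} {E} (k≻ ∷ ord) (there ∈ks) = begin
  at k (s ∷ E) ++ swept ks (s ∷ E)
    ≡⟨ cong (_++ swept ks (s ∷ E)) (List.filter-reject (λ s → level s ≟ k) (≻⇒≢ (All.lookup k≻ ∈ks) ∘ sym)) ⟩
  at k E ++ swept ks (s ∷ E)    ↭⟨ ++⁺ˡ (at k E) (swept-∷ ord ∈ks) ⟩
  at k E ++ s ∷ swept ks E      ↭⟨ shift s (at k E) (swept ks E) ⟩
  s ∷ at k E ++ swept ks E      ∎
  where open PermutationReasoning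

-- The levels in `ks` are distinct and cover those of `E`, so each step is listed exactly once.
swept-↭ : ∀ {ks E} → AllPairs _≻_ ks → All (λ s → level s ∈ ks) E → swept ks E ↭ E
swept-↭ {[]}     {[]}    _   _  = refl
swept-↭ {k ∷ ks} {[]}    (_ ∷ ord) _  = swept-↭ ord []
swept-↭ {ks}     {s ∷ E} ord (∈ks ∷ ∈kss) = ↭-trans (swept-∷ ord ∈ks) (prep s (swept-↭ ord ∈kss))

at-swept-∉ : ∀ {k} ks E → All (k ≢_) ks → at k (swept ks E) ≡ []
at-swept-∉ []       E _ = refl
at-swept-∉ {k} (k′ ∷ ks) E (k≢ ∷ k≢s) = ≡.trans (List.filter-++ (λ s → level s ≟ k) (at k′ E) (swept ks E))
  (cong₂ _++_
    (List.filter-none (λ s → level s ≟ k)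
      (All.map (λ eq eq′ → k≢ (≡.trans (sym eq′) eq)) (All.all-filter (λ s → level s ≟ k′) E)))
    (at-swept-∉ ks E k≢s))

-- Sorting by level keeps the order within a level. This lets the sequence of letters at each level
-- be read off from the swept list.
at-swept : ∀ {k ks} E → AllPairs _≻_ ks → k ∈ ks → at k (swept ks E) ≡ at k E
at-swept {k} {_ ∷ ks} E (k≻ ∷ _) (here refl) = begin
  at k (at k E ++ swept ks E)         ≡⟨ List.filter-++ (λ s → level s ≟ k) (at k E) (swept ks E) ⟩
  at k (at k E) ++ at k (swept ks E)  ≡⟨ cong₂ _++_ (List.filter-idem (λ s → level s ≟ k) E)
                                                    (at-swept-∉ ks E (All.map ≻⇒≢ k≻)) ⟩
  at k E ++ []                        ≡⟨ List.++-identityʳ (at k E) ⟩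
  at k E                              ∎
  where open ≡-Reasoning
at-swept {k} {k′ ∷ ks} E (k′≻ ∷ ord) (there k∈) = begin
  at k (at k′ E ++ swept ks E)         ≡⟨ List.filter-++ (λ s → level s ≟ k) (at k′ E) (swept ks E) ⟩
  at k (at k′ E) ++ at k (swept ks E)  ≡⟨ cong₂ _++_ none (at-swept E ord k∈) ⟩
  at k E                               ∎
  where
  open ≡-Reasoning
  none : at k (at k′ E) ≡ []
  none = List.filter-none (λ s → level s ≟ k)
    (All.map (λ eq eq′ → ≻⇒≢ (All.lookup k′≻ k∈) (≡.trans (sym eq) eq′)) (All.all-filter (λ s → level s ≟ k′) E))

_later_ : Step → Step → Set
a later b = time b ℕ.< time a

steps-later : ∀ r → AllPairs _later_ (steps r)
steps-later []      = []
steps-later (x ∷ r) = All.tabulate (λ s∈ → ℕ.s≤s (time-≤-length r s∈)) ∷ steps-later r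

same-level-▷ : ∀ {k E} → All (λ s → level s ≡ k) E → AllPairs _later_ E → AllPairs _▷_ E
same-level-▷ []         []           = []
same-level-▷ (eq ∷ eqs) (lts ∷ ltss) =
  All.zipWith (λ (eq′ , lt) → inj₂ (≡.trans eq (sym eq′) , lt)) (eqs , lts) ∷ same-level-▷ eqs ltss

swept-▷ : ∀ {ks E} → AllPairs _≻_ ks → AllPairs _later_ E → AllPairs _▷_ (swept ks E)
swept-▷ {ks} {E} ord later = AllPairs.concat⁺
  (All.map⁺ (All.universal (λ k → same-level-▷ (level-at k) (AllPairs.filter⁺ (λ s → level s ≟ k) later)) ks))
  (AllPairs.map⁺ (AllPairs.map across ord))
  where
  level-at : ∀ k → All (λ s → level s ≡ k) (at k E)
  level-at k = All.all-filter (λ s → level s ≟ k) E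
  across : ∀ {k k′} → k ≻ k′ → All (λ a → All (a ▷_) (at k′ E)) (at k E)
  across {k} {k′} k≻k′ = All.map (λ eq → All.map (λ eq′ → inj₁ (≡.subst₂ _≻_ (sym eq) (sym eq′) k≻k′))
                                                 (level-at k′)) (level-at k)

sweepOrder : ℕ → List ℤ
sweepOrder m = negLevels m ++ nonnegLevels m

negLevels-range : ∀ m → All (λ k → ∃ λ i → k ≡ -[1+ i ] × i ℕ.< m) (negLevels m)
negLevels-range zero    = []
negLevels-range (suc m) = All.++⁺ (All.map (λ (i , eq , lt) → i , eq , ℕ.m<n⇒m<1+n lt) (negLevels-range m))
                                  ((m , refl , ℕ.≤-refl) ∷ [])

nonnegLevels-range : ∀ m → All (λ k → ∃ λ i → k ≡ ℤ.+ i × i ℕ.≤ m) (nonnegLevels m)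
nonnegLevels-range zero    = (0 , refl , ℕ.≤-refl) ∷ []
nonnegLevels-range (suc m) = (suc m , refl , ℕ.≤-refl) ∷
  All.map (λ (i , eq , le) → i , eq , ℕ.m≤n⇒m≤1+n le) (nonnegLevels-range m)

sweepOrder-≻ : ∀ m → AllPairs _≻_ (sweepOrder m)
sweepOrder-≻ m = AllPairs.++⁺ (negative m) (nonnegative m)
  (All.map (λ { (_ , refl , _) → All.map (λ { (_ , refl , _) → inj₁ (+<+ (ℕ.s≤s ℕ.z≤n)) }) (nonnegLevels-range m) })
           (negLevels-range m))
  where
  negative : ∀ m → AllPairs _≻_ (negLevels m)
  negative zero    = []
  negative (suc m) = AllPairs.++⁺ (negative m) ([] ∷ [])
    (All.map (λ { (_ , refl , lt) → inj₂ (refl , -<- lt) ∷ [] }) (negLevels-range m))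
  nonnegative : ∀ m → AllPairs _≻_ (nonnegLevels m)
  nonnegative zero    = [] ∷ []
  nonnegative (suc m) =
    All.map (λ { (_ , refl , le) → inj₂ (refl , +<+ (ℕ.s≤s le)) }) (nonnegLevels-range m) ∷ nonnegative m

∈-sweepOrder : ∀ {m} k → ∣ k ∣ ℕ.≤ m → k ∈ sweepOrder m
∈-sweepOrder {m} (ℤ.+ i)  le = ∈-++⁺ʳ (negLevels m) (go m le)
  where
  go : ∀ m → i ℕ.≤ m → ℤ.+ i ∈ nonnegLevels m
  go zero    ℕ.z≤n = here refl
  go (suc m) le with i ℕ.≟ suc m
  ... | yes refl = here refl
  ... | no  i≢   = there (go m (ℕ.s≤s⁻¹ (ℕ.≤∧≢⇒< le i≢)))
∈-sweepOrder {m} -[1+ i ] lt = ∈-++⁺ˡ (go m lt)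
  where
  go : ∀ m → i ℕ.< m → -[1+ i ] ∈ negLevels m
  go (suc m) lt with i ℕ.≟ m
  ... | yes refl = ∈-++⁺ʳ (negLevels m) (here refl)
  ... | no  i≢   = ∈-++⁺ˡ (go m (ℕ.≤∧≢⇒< (ℕ.s≤s⁻¹ lt) i≢))

∣total∣≤bound : ∀ r → ∣ total r ∣ ℕ.≤ bound r
∣total∣≤bound []      = ℕ.z≤n
∣total∣≤bound (x ∷ r) = ℕ.≤-trans (ℤ.∣i+j∣≤∣i∣+∣j∣ x (total r)) (ℕ.+-monoʳ-≤ ∣ x ∣ (∣total∣≤bound r))

∣level∣≤bound : ∀ r → All (λ s → ∣ level s ∣ ℕ.≤ bound r) (steps r)
∣level∣≤bound []      = []
∣level∣≤bound (x ∷ r) = ∣total∣≤bound (x ∷ r) ∷ All.map (λ le → ℕ.≤-trans le (ℕ.m≤n+m _ ∣ x ∣)) (∣level∣≤bound r)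

levelsFrom-++ : ∀ s xs ys → levelsFrom s (xs ++ ys) ≡ levelsFrom s xs ++ levelsFrom (s + total xs) ys
levelsFrom-++ s []       ys = cong (λ t → levelsFrom t ys) (sym (ℤ.+-identityʳ s))
levelsFrom-++ s (x ∷ xs) ys = cong ((x , s + x) ∷_) (≡.trans (levelsFrom-++ (s + x) xs ys)
  (cong (λ t → levelsFrom (s + x) xs ++ levelsFrom t ys) (ℤ.+-assoc s x (total xs))))

letter-level : Step → ℤ × ℤ
letter-level s = letter s , level s

reverse-levels : ∀ r → reverse (levels (reverse r)) ≡ map letter-level (steps r)
reverse-levels []      = refl
reverse-levels (x ∷ r) = begin
  reverse (levels (reverse (x ∷ r)))
    ≡⟨ cong (reverse ∘ levels) (List.unfold-reverse x r) ⟩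
  reverse (levels (reverse r ++ [ x ]))
    ≡⟨ cong reverse (levelsFrom-++ 0ℤ (reverse r) [ x ]) ⟩
  reverse (levels (reverse r) ++ [ x , (0ℤ + total (reverse r)) + x ])
    ≡⟨ List.reverse-++ (levels (reverse r)) [ x , (0ℤ + total (reverse r)) + x ] ⟩
  (x , (0ℤ + total (reverse r)) + x) ∷ reverse (levels (reverse r))
    ≡⟨ cong₂ (λ l ls → (x , l) ∷ ls) level≡ (reverse-levels r) ⟩
  (x , x + total r) ∷ map letter-level (steps r) ∎
  where
  open ≡-Reasoning
  level≡ : (0ℤ + total (reverse r)) + x ≡ x + total r
  level≡ = begin
    (0ℤ + total (reverse r)) + x  ≡⟨ ℤ.+-comm _ x ⟩
    x + (0ℤ + total (reverse r))  ≡⟨ cong (λ t → x + t) (ℤ.+-identityˡ (total (reverse r))) ⟩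
    x + total (reverse r)         ≡⟨ cong (λ t → x + t) (∑-↭ (λ y → y) (↭-reverse r)) ⟩
    x + total r                   ∎

lettersAt-steps : ∀ w k → lettersAt w k ≡ map letter (at k (steps (reverse w)))
lettersAt-steps w k = begin
  map proj₁ (filter (λ p → proj₂ p ≟ k) (reverse (levels w)))
    ≡⟨ cong (λ v → map proj₁ (filter (λ p → proj₂ p ≟ k) (reverse (levels v)))) (List.reverse-involutive w) ⟨
  map proj₁ (filter (λ p → proj₂ p ≟ k) (reverse (levels (reverse (reverse w)))))
    ≡⟨ cong (λ ps → map proj₁ (filter (λ p → proj₂ p ≟ k) ps)) (reverse-levels (reverse w)) ⟩
  map proj₁ (filter (λ p → proj₂ p ≟ k) (map letter-level (steps (reverse w))))
    ≡⟨ cong (map proj₁) (filter-map (λ p → proj₂ p ≟ k) letter-level (steps (reverse w))) ⟩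
  map proj₁ (map letter-level (at k (steps (reverse w))))
    ≡⟨ List.map-∘ (at k (steps (reverse w))) ⟨
  map letter (at k (steps (reverse w))) ∎
  where open ≡-Reasoning

sweepSteps : List ℤ → List Step
sweepSteps w = swept (sweepOrder (bound w)) (steps (reverse w))

sweep-steps : ∀ w → sweep w ≡ map letter (sweepSteps w)
sweep-steps w = ≡.trans (List.concatMap-cong (lettersAt-steps w) (sweepOrder (bound w)))
                        (sym (List.map-concatMap letter (λ k → at k (steps (reverse w))) (sweepOrder (bound w))))

bound-↭ : ∀ {u v} → u ↭ v → bound u ≡ bound v
bound-↭ u↭v = sum-↭ (map⁺ ∣_∣ u↭v)

level∈sweepOrder : ∀ w → All (λ s → level s ∈ sweepOrder (bound w)) (steps (reverse w))
level∈sweepOrder w = All.map (λ {s} le → ∈-sweepOrder (level s) (subst (∣ level s ∣ ℕ.≤_) (bound-↭ (↭-reverse w)) le))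
                             (∣level∣≤bound (reverse w))

sweepSteps-↭ : ∀ w → sweepSteps w ↭ steps (reverse w)
sweepSteps-↭ w = swept-↭ (sweepOrder-≻ (bound w)) (level∈sweepOrder w)

letters-steps : ∀ r → map letter (steps r) ≡ r
letters-steps []      = refl
letters-steps (x ∷ r) = cong (x ∷_) (letters-steps r)

sweep-↭ : ∀ w → sweep w ↭ w
sweep-↭ w = begin
  sweep w                          ≡⟨ sweep-steps w ⟩
  map letter (sweepSteps w)        ↭⟨ map⁺ letter (sweepSteps-↭ w) ⟩
  map letter (steps (reverse w))   ≡⟨ letters-steps (reverse w) ⟩
  reverse w                        ↭⟨ ↭-reverse w ⟩
  w                                ∎
  where open PermutationReasoning

nonzero-≻0 : ∀ a → a ≢ 0ℤ → a ≻ 0ℤ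
nonzero-≻0 (ℤ.+ zero)  a≢0 = contradiction refl a≢0
nonzero-≻0 (ℤ.+ suc n) _   = inj₂ (refl , +<+ (ℕ.s≤s ℕ.z≤n))
nonzero-≻0 -[1+ n ]               _   = inj₁ (+<+ (ℕ.s≤s ℕ.z≤n))

closedSteps : List ℤ → List Step
closedSteps w = sweepSteps w ∷ʳ start (reverse w)

closedSteps-↭ : ∀ w → closedSteps w ↭ closed (reverse w)
closedSteps-↭ w = ↭-trans (↭-sym (∷↭∷ʳ (start (reverse w)) (sweepSteps w))) (prep _ (sweepSteps-↭ w))

-- Level 0 is swept last, and time 0 comes last within it, so the closing step can be appended
-- without disturbing the order.
closedSteps-▷ : ∀ w → AllPairs _▷_ (closedSteps w)
closedSteps-▷ w = AllPairs.++⁺ (swept-▷ (sweepOrder-≻ (bound w)) (steps-later (reverse w))) ([] ∷ [])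
  (All.tabulate (λ {s} s∈ → ▷start s (∈-resp-↭ (sweepSteps-↭ w) s∈) ∷ []))
  where
  ▷start : ∀ s → s ∈ steps (reverse w) → s ▷ start (reverse w)
  ▷start s s∈ with level s ≟ 0ℤ
  ... | yes eq = inj₂ (eq , ℕ.n≢0⇒n>0 (time-≢0 (reverse w) s∈))
  ... | no neq = inj₁ (nonzero-≻0 (level s) neq)

-- Injectivity of the sweep.

align : ∀ {C : Set} (f : A → C) (g : B → C) xs ys → map f xs ≡ map g ys →
  ∃ λ zs → map proj₁ zs ≡ xs × map proj₂ zs ≡ ys × All (λ (x , y) → f x ≡ g y) zs
align f g []       []       _  = [] , refl , refl , []
align f g (x ∷ xs) (y ∷ ys) eq with align f g xs ys (List.∷-injectiveʳ eq)
... | zs , refl , refl , all = (x , y) ∷ zs , refl , refl , List.∷-injectiveˡ eq ∷ all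

-- The last letter of a word sits at the level `total r`, and it is the first one listed there. So
-- the total and the lists by level determine it; removing it leaves the same data for a shorter
-- word.
rebuild : ∀ {ks} r r′ → length r ≡ length r′ → total r ≡ total r′ → All (λ s → level s ∈ ks) (steps r) →
  (∀ {k} → k ∈ ks → map letter (at k (steps r)) ≡ map letter (at k (steps r′))) → r ≡ r′
rebuild []      []        _    _    _          _    = refl
rebuild {ks} (x ∷ r) (x′ ∷ r′) len≡ sum≡ (∈ks ∷ ∈kss) at≡ = cong₂ _∷_ x≡x′
  (rebuild r r′ (ℕ.suc-injective len≡) total≡ ∈kss rest)
  where
  open ≡-Reasoning
  s s′ : Step
  s  = step (suc (length r)) x (x + total r)
  s′ = step (suc (length r′)) x′ (x′ + total r′)
  accept : ∀ s E {k} → level s ≡ k → map letter (at k (s ∷ E)) ≡ letter s ∷ map letter (at k E)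
  accept s E {k} eq = cong (map letter) (List.filter-accept (λ s → level s ≟ k) eq)
  reject : ∀ s E {k} → level s ≢ k → map letter (at k (s ∷ E)) ≡ map letter (at k E)
  reject s E {k} neq = cong (map letter) (List.filter-reject (λ s → level s ≟ k) neq)
  both : ∀ {k} → k ∈ ks → level s ≡ k → x ∷ map letter (at k (steps r)) ≡ x′ ∷ map letter (at k (steps r′))
  both k∈ eq = ≡.trans (sym (accept s (steps r) eq))
                       (≡.trans (at≡ k∈) (accept s′ (steps r′) (≡.trans (sym sum≡) eq)))
  x≡x′ : x ≡ x′
  x≡x′ = List.∷-injectiveˡ (both ∈ks refl)
  total≡ : total r ≡ total r′
  total≡ = ≡.trans (sym (i+j-i≡j x (total r))) (≡.trans (cong₂ _-_ sum≡ x≡x′) (i+j-i≡j x′ (total r′)))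
  rest : ∀ {k} → k ∈ ks → map letter (at k (steps r)) ≡ map letter (at k (steps r′))
  rest {k} k∈ with level s ≟ k
  ... | yes eq = List.∷-injectiveʳ (both k∈ eq)
  ... | no neq = ≡.trans (sym (reject s (steps r) neq))
                         (≡.trans (at≡ k∈) (reject s′ (steps r′) (neq ∘ ≡.trans sum≡)))

sweepSteps-determined : ∀ u v → sweep u ≡ sweep v → total u ≡ total v →
  map letter-level (sweepSteps u) ≡ map letter-level (sweepSteps v)
sweepSteps-determined u v eq total≡
  -- A position of the common sweep is modelled as the pair of steps that it comes from in the two
  -- words.
  with align letter letter (sweepSteps u) (sweepSteps v) (≡.trans (sym (sweep-steps u)) (≡.trans eq (sweep-steps v)))
... | Z , Z₁ , Z₂ , letters = begin
  map letter-level (sweepSteps u)         ≡⟨ cong (map letter-level) Z₁ ⟨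
  map letter-level (map proj₁ Z)          ≡⟨ List.map-∘ Z ⟨
  map (letter-level ∘ proj₁) Z            ≡⟨ List.map-cong-local (All.tabulate λ z∈ →
                                               cong₂ _,_ (All.lookup letters z∈) (level≡ (∈-++⁺ˡ z∈))) ⟩
  map (letter-level ∘ proj₂) Z            ≡⟨ List.map-∘ Z ⟩
  map letter-level (map proj₂ Z)          ≡⟨ cong (map letter-level) Z₂ ⟩
  map letter-level (sweepSteps v)         ∎
  where
  open ≡-Reasoning
  z₀ = start (reverse u) , start (reverse v)
  Z⁺ = Z ∷ʳ z₀
  Z⁺₁ : map proj₁ Z⁺ ≡ closedSteps u
  Z⁺₁ = ≡.trans (List.map-++ proj₁ Z [ z₀ ]) (cong (_∷ʳ start (reverse u)) Z₁)
  Z⁺₂ : map proj₂ Z⁺ ≡ closedSteps v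
  Z⁺₂ = ≡.trans (List.map-++ proj₂ Z [ z₀ ]) (cong (_∷ʳ start (reverse v)) Z₂)
  Z⁺↭₁ : map proj₁ Z⁺ ↭ closed (reverse u)
  Z⁺↭₁ = ↭-trans (↭-reflexive Z⁺₁) (closedSteps-↭ u)
  Z⁺↭₂ : map proj₂ Z⁺ ↭ closed (reverse v)
  Z⁺↭₂ = ↭-trans (↭-reflexive Z⁺₂) (closedSteps-↭ v)
  sorted₁ : AllPairs (λ a b → proj₁ a ▷ proj₁ b) Z⁺
  sorted₁ = AllPairs.map⁻ (subst (AllPairs _▷_) (sym Z⁺₁) (closedSteps-▷ u))
  sorted₂ : AllPairs (λ a b → proj₂ a ▷ proj₂ b) Z⁺
  sorted₂ = AllPairs.map⁻ (subst (AllPairs _▷_) (sym Z⁺₂) (closedSteps-▷ v))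
  total-reverse : ∀ w → total (reverse w) ≡ total w
  total-reverse w = ∑-↭ (λ x → x) (↭-reverse w)
  letters⁺ : All (λ z → letter (proj₁ z) ≡ letter (proj₂ z)) Z⁺
  letters⁺ = All.++⁺ letters
    -- The closing letters are the negated totals, so they agree because the totals do.
    (cong -_ (≡.trans (total-reverse u) (≡.trans total≡ (sym (total-reverse v)))) ∷ [])
  z₀∈ : z₀ ∈ Z⁺
  z₀∈ = ∈-++⁺ʳ Z (here refl)
  level≡ : ∀ {z} → z ∈ Z⁺ → level (proj₁ z) ≡ level (proj₂ z)
  level≡ z∈ = cong proj₂ (≼-antisym
    (Comparison.level-≼ Z⁺ proj₁ proj₂ (reverse u) (reverse v) Z⁺↭₁ Z⁺↭₂
      (All.lookup letters⁺) (AllPairs.zip (sorted₁ , sorted₂)) z₀∈ refl refl z∈)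
    (Comparison.level-≼ Z⁺ proj₂ proj₁ (reverse v) (reverse u) Z⁺↭₂ Z⁺↭₁
      (sym ∘ All.lookup letters⁺) (AllPairs.zip (sorted₂ , sorted₁)) z₀∈ refl refl z∈))

sweep-injective : ∀ {u v} → sweep u ≡ sweep v → u ≡ v
sweep-injective {u} {v} eq = List.reverse-injective
  (rebuild (reverse u) (reverse v) (↭-length ru↭rv) (∑-↭ (λ x → x) ru↭rv) (level∈sweepOrder u) same)
  where
  open ≡-Reasoning
  u↭v : u ↭ v
  u↭v = ↭-trans (↭-sym (sweep-↭ u)) (↭-trans (↭-reflexive eq) (sweep-↭ v))
  ru↭rv : reverse u ↭ reverse v
  ru↭rv = ↭-trans (↭-reverse u) (↭-trans u↭v (↭-sym (↭-reverse v)))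
  extract : ℤ → List (ℤ × ℤ) → List ℤ
  extract k ps = map proj₁ (filter (λ p → proj₂ p ≟ k) ps)
  extract-map : ∀ k E → extract k (map letter-level E) ≡ map letter (at k E)
  extract-map k E = ≡.trans (cong (map proj₁) (filter-map (λ p → proj₂ p ≟ k) letter-level E))
                            (sym (List.map-∘ (at k E)))
  at-sweepSteps : ∀ {k} w → k ∈ sweepOrder (bound w) →
    extract k (map letter-level (sweepSteps w)) ≡ map letter (at k (steps (reverse w)))
  at-sweepSteps {k} w k∈ = ≡.trans (extract-map k (sweepSteps w))
    (cong (map letter) (at-swept (steps (reverse w)) (sweepOrder-≻ (bound w)) k∈))
  same : ∀ {k} → k ∈ sweepOrder (bound u) →
    map letter (at k (steps (reverse u))) ≡ map letter (at k (steps (reverse v)))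
  same {k} k∈ = begin
    map letter (at k (steps (reverse u)))         ≡⟨ at-sweepSteps u k∈ ⟨
    extract k (map letter-level (sweepSteps u))   ≡⟨ cong (extract k) (sweepSteps-determined u v eq (∑-↭ (λ x → x) u↭v)) ⟩
    extract k (map letter-level (sweepSteps v))   ≡⟨ at-sweepSteps v (subst (λ m → k ∈ sweepOrder m) (bound-↭ u↭v) k∈) ⟩
    map letter (at k (steps (reverse v)))         ∎

-- Surjectivity from injectivity on finite orbits.

decode : ∀ (v : List A) n → Fin (length v ℕ.^ n) → List A
decode v n c = tabulate {n = n} (λ i → lookup v (finToFun c i))

-- Each letter of `w` is coded by a position in `v` where it occurs. Hence the words of a fixed
-- length over the letters of `v` are exhausted by finitely many codes.
decode-surjective : ∀ {v w : List A} → All (_∈ v) w → ∃ λ c → decode v (length w) c ≡ w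
decode-surjective {v = v} {w} w⊆v = funToFin (proj₁ (choose w⊆v)) ,
  ≡.trans (List.tabulate-cong (cong (lookup v) ∘ Fin.finToFun-funToFin (proj₁ (choose w⊆v)))) (proj₂ (choose w⊆v))
  where
  choose : ∀ {w} → All (_∈ v) w → ∃ λ (f : Fin (length w) → Fin (length v)) → tabulate (lookup v ∘ f) ≡ w
  choose []          = (λ ()) , refl
  choose (x∈ ∷ w⊆v) with choose w⊆v
  ... | f , eq = (λ { zero → Any.index x∈ ; (suc i) → f i }) , cong₂ _∷_ (sym (Any.lookup-index x∈)) eq

-- Two members of the orbit of v coincide; cancelling f, the orbit returns to v.
↭-injective⇒preimage : (f : List A → List A) → (∀ {u v} → f u ≡ f v → u ≡ v) → (∀ w → f w ↭ w) →
  ∀ v → ∃ λ u → v ↭ u × f u ≡ v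
↭-injective⇒preimage {A = A} f f-injective f-↭ v =
  -- There is one more index than there are codes, so two iterates share a code.
  let i , j , i<j , eq = Fin.pigeonhole ℕ.≤-refl code
  in  descend (toℕ i) (toℕ j) i<j
        (≡.trans (sym (decode-code i)) (≡.trans (cong (decode v (length v)) eq) (decode-code j)))
  where
  iterate : ℕ → List A
  iterate = fold v f

  iterate-↭ : ∀ n → iterate n ↭ v
  iterate-↭ zero    = refl
  iterate-↭ (suc n) = ↭-trans (f-↭ (iterate n)) (iterate-↭ n)

  encode : ∀ n → ∃ λ c → decode v (length v) c ≡ iterate n
  -- All iterates have the length of `v`, which brings their codes into one fixed finite type.
  encode n = subst (λ m → ∃ λ c → decode v m c ≡ iterate n) (↭-length (iterate-↭ n))
    (decode-surjective (All-resp-↭ (↭-sym (iterate-↭ n)) (All.tabulate (λ x∈ → x∈))))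

  code : Fin (suc (length v ℕ.^ length v)) → Fin (length v ℕ.^ length v)
  code i = proj₁ (encode (toℕ i))

  decode-code : ∀ i → decode v (length v) (code i) ≡ iterate (toℕ i)
  decode-code i = proj₂ (encode (toℕ i))

  descend : ∀ i j → i ℕ.< j → iterate i ≡ iterate j → ∃ λ u → v ↭ u × f u ≡ v
  descend zero    (suc n) _   eq = iterate n , ↭-sym (iterate-↭ n) , sym eq
  descend (suc i) (suc j) i<j eq = descend i j (ℕ.s≤s⁻¹ i<j) (f-injective eq)

-- Restriction to the words with prescribed letter counts.

InA-↭ : ∀ {n} (a : Vec ℤ n) (e : Vec ℕ n) {u v} → u ↭ v → InA a e u → InA a e v
InA-↭ a e u↭v (counts , letters) =
  (λ j → ≡.trans (sym (↭-length (filter-↭ (_≟ Vec.lookup a j) u↭v))) (counts j)) , All-resp-↭ u↭v letters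

theorem6p1 : (n : ℕ) (a : Vec ℤ n) (e : Vec ℕ n) →
    ((w : List ℤ) → InA a e w → InA a e (sweep w))
    × ((u v : List ℤ) → InA a e u → InA a e v → sweep u ≡ sweep v → u ≡ v)
    × ((v : List ℤ) → InA a e v → Σ (List ℤ) (λ u → InA a e u × sweep u ≡ v))
theorem6p1 n a e =
  (λ w → InA-↭ a e (↭-sym (sweep-↭ w))) , (λ u v _ _ → sweep-injective) , preimage
  where
  preimage : (v : List ℤ) → InA a e v → Σ (List ℤ) (λ u → InA a e u × sweep u ≡ v)
  preimage v v∈A =
    let u , v↭u , eq = ↭-injective⇒preimage sweep sweep-injective sweep-↭ v
    in  u , InA-↭ a e v↭u v∈A , eq
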